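{- Every edge-coloured graph $G$ satisfies $t(C_6^A,G)\leq (1/2)^6$.
   Context: An edge-coloured graph is a (finite, simple) graph each of whose edges is coloured either red or blue. For $k\geq 2$, the alternating cycle $C_{2k}^A$ is the edge-coloured graph consisting of the cycle $C_{2k}$ in which every vertex is incident to exactly one red edge and exactly one blue edge. A homomorphism from an edge-coloured graph $H$ to an edge-coloured graph $G$ is a map $f:V(H)\to V(G)$ such that whenever $uv$ is an edge of $H$, $f(u)f(v)$ is an edge of $G$ of the same colour as $uv$. Let $\hom(H,G)$ denote the number of homomorphisms from $H$ to $G$, and define the homomorphism density $t(H,G)=\hom(H,G)/v(G)^{v(H)}$, where $v(\cdot)$ denotes the number of vertices. -}

module Defs where

open import Data.Nat using (ℕ; zero; suc; _^_; NonZero)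
open import Data.Nat.Properties using (m^n≢0)
open import Data.Fin using (Fin; zero; suc)
open import Data.Fin.Properties using (all?)
open import Data.Maybe using (Maybe; just; nothing)
open import Data.Unit using (⊤; tt)
open import Data.Vec using (Vec; []; _∷_; lookup)
open import Data.List using (List; []; _∷_; [_]; map; concatMap; allFin; filter; length)
open import Data.Integer using (+_)
open import Data.Rational using (ℚ; _/_; ½; _*_)
open import Relation.Binary.PropositionalEquality using (_≡_; refl)
open import Relation.Nullary using (Dec; yes; no)

data Colour : Set where
  red blue : Colour

colour-≟ : (c d : Colour) → Dec (c ≡ d)
colour-≟ red red = yes refl
colour-≟ red blue = no (λ ())
colour-≟ blue red = no (λ ())
colour-≟ blue blue = yes refl

-- A finite simple edge-coloured graph on vertex set Fin n:
-- col u v = nothing  (no edge),  just c  (edge uv of colour c).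
record ECGraph (n : ℕ) : Set where
  field
    col    : Fin n → Fin n → Maybe Colour
    sym    : ∀ u v → col u v ≡ col v u
    irrefl : ∀ u → col u u ≡ nothing
open ECGraph public

v : ∀ {n} → ECGraph n → ℕ
v {n} _ = n

EdgeOK : Maybe Colour → Maybe Colour → Set
EdgeOK nothing  _ = ⊤
EdgeOK (just c) d = d ≡ just c

edgeOK? : ∀ a b → Dec (EdgeOK a b)
edgeOK? nothing b = yes tt
edgeOK? (just c) nothing = no (λ ())
edgeOK? (just c) (just d) with colour-≟ d c
... | yes refl = yes refl
... | no ne = no (λ { refl → ne refl })

IsHom : ∀ {k n} → ECGraph k → ECGraph n → Vec (Fin n) k → Set
IsHom H G f = ∀ u w → EdgeOK (col H u w) (col G (lookup f u) (lookup f w))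

isHom? : ∀ {k n} (H : ECGraph k) (G : ECGraph n) (f : Vec (Fin n) k) → Dec (IsHom H G f)
isHom? H G f = all? (λ u → all? (λ w → edgeOK? (col H u w) (col G (lookup f u) (lookup f w))))

allMaps : (k n : ℕ) → List (Vec (Fin n) k)
allMaps zero    n = [ [] ]
allMaps (suc k) n = concatMap (λ x → map (x ∷_) (allMaps k n)) (allFin n)

hom : ∀ {k n} → ECGraph k → ECGraph n → ℕ
hom {k} {n} H G = length (filter (isHom? H G) (allMaps k n))

t : ∀ {k n} → ECGraph k → (G : ECGraph n) → .{{NonZero n}} → ℚ
t {k} {n} H G = (+ hom H G) / (n ^ k)
  where instance _ = m^n≢0 n k

-- Alternating 6-cycle C_6^A: vertices 0..5, edges i(i+1 mod 6),
-- coloured red for i even and blue for i odd.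
c6col : Fin 6 → Fin 6 → Maybe Colour
c6col zero (suc zero) = just red
c6col (suc zero) zero = just red
c6col (suc zero) (suc (suc zero)) = just blue
c6col (suc (suc zero)) (suc zero) = just blue
c6col (suc (suc zero)) (suc (suc (suc zero))) = just red
c6col (suc (suc (suc zero))) (suc (suc zero)) = just red
c6col (suc (suc (suc zero))) (suc (suc (suc (suc zero)))) = just blue
c6col (suc (suc (suc (suc zero)))) (suc (suc (suc zero))) = just blue
c6col (suc (suc (suc (suc zero)))) (suc (suc (suc (suc (suc zero))))) = just red
c6col (suc (suc (suc (suc (suc zero))))) (suc (suc (suc (suc zero)))) = just red
c6col (suc (suc (suc (suc (suc zero))))) zero = just blue
c6col zero (suc (suc (suc (suc (suc zero))))) = just blue
c6col _ _ = nothing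

C6A : ECGraph 6
C6A = record { col = c6col ; sym = s ; irrefl = i }
  where
  all6 : (P : Fin 6 → Set) → P zero → P (suc zero) → P (suc (suc zero))
       → P (suc (suc (suc zero))) → P (suc (suc (suc (suc zero))))
       → P (suc (suc (suc (suc (suc zero))))) → ∀ x → P x
  all6 P a b c d e f zero = a
  all6 P a b c d e f (suc zero) = b
  all6 P a b c d e f (suc (suc zero)) = c
  all6 P a b c d e f (suc (suc (suc zero))) = d
  all6 P a b c d e f (suc (suc (suc (suc zero)))) = e
  all6 P a b c d e f (suc (suc (suc (suc (suc zero))))) = f
  s : ∀ u w → c6col u w ≡ c6col w u
  s = all6 _ (all6 _ refl refl refl refl refl refl) (all6 _ refl refl refl refl refl refl)
             (all6 _ refl refl refl refl refl refl) (all6 _ refl refl refl refl refl refl)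
             (all6 _ refl refl refl refl refl refl) (all6 _ refl refl refl refl refl refl)
  i : ∀ u → c6col u u ≡ nothing
  i = all6 _ refl refl refl refl refl refl

half^6 : ℚ
half^6 = ½ * ½ * ½ * ½ * ½ * ½

{-# OPTIONS --safe #-}

-- Let J be the all-ones matrix and let A have entry 1 at the red pairs and −1 elsewhere, so that
-- the red adjacency matrix is (J + A)/2 and the blue one is at most (J − A)/2. Hence 64 hom(C₆ᴬ, G) ≤ tr(M³)
-- for M = (J + A)(J − A), and it suffices that tr(M³) ≤ n⁶. Writing Aᵢ for the i-th row of A and
-- a = A𝟏, b = Aa, expanding the trace gives
--   n⁶ − tr(M³) = tr(A⁶) + 3 ∑ᵢ (n (n |a|² − bᵢ²) + Gram(Aᵢ, a, 𝟏)),
-- where n |a|² − bᵢ² = |Aᵢ|² |a|² − ⟨Aᵢ, a⟩² ≥ 0, and Gram determinants are nonnegative.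

module Submission where

open import Defs hiding (sym)
open import Data.Fin using (Fin; zero; suc)
open import Data.Fin.Patterns using (0F; 1F; 2F; 3F; 4F; 5F)
open import Data.Integer as ℤ using (ℤ; +_; 0ℤ; 1ℤ; -1ℤ; _+_; _*_; _-_; -_)
import Data.Integer.Properties as ℤ
open import Data.Integer.Tactic.RingSolver using (solve-∀)
open import Data.List using (List; []; _∷_; _++_; map; concatMap; tabulate; filter; length)
open import Data.Maybe using (Maybe; just; nothing)
open import Data.Nat using (ℕ; zero; suc; _^_; NonZero; z≤n)
open import Data.Nat.Properties using (m^n≢0)
open import Data.Rational using (_/_; _≤_)
import Data.Rational.Properties as ℚ
import Data.Rational.Unnormalised as ℚᵘ
import Data.Rational.Unnormalised.Properties as ℚᵘ
open import Data.Vec using (Vec; []; _∷_)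
open import Data.Vec.Functional using (Vector)
open import Relation.Binary.PropositionalEquality
  using (_≡_; _≗_; refl; sym; trans; cong; cong₂; subst; subst₂; module ≡-Reasoning)
open import Relation.Nullary using (Dec; yes; no)

open import Algebra.Properties.Semiring.Sum ℤ.+-*-semiring
  using (sum; sum-syntax; sum-cong-≗; sum-replicate-zero; ∑-distrib-+; ∑-comm; *-distribˡ-sum; *-distribʳ-sum)
open ≡-Reasoning

private
  variable
    n : ℕ

-- Integer inequalities and finite sums.

square-nonneg : ∀ x → 0ℤ ℤ.≤ x * x
square-nonneg (+ m) = subst (0ℤ ℤ.≤_) (ℤ.pos-* m m) (ℤ.+≤+ z≤n)
square-nonneg ℤ.-[1+ m ] = ℤ.+≤+ z≤n

*-nonneg : ∀ {x y} → 0ℤ ℤ.≤ x → 0ℤ ℤ.≤ y → 0ℤ ℤ.≤ x * y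
*-nonneg {+ k} {+ l} _ _ = subst (0ℤ ℤ.≤_) (ℤ.pos-* k l) (ℤ.+≤+ z≤n)

-- Stands in for division: an inequality over ℤ is first proved after scaling by a positive integer.
nonneg-cancelˡ : ∀ n .{{_ : NonZero n}} {x} → 0ℤ ℤ.≤ + n * x → 0ℤ ℤ.≤ x
nonneg-cancelˡ (suc m) {x} h =
  ℤ.*-cancelˡ-≤-pos 0ℤ x (+ suc m) (subst (ℤ._≤ + suc m * x) (sym (ℤ.*-zeroʳ (+ suc m))) h)

sum-mono : {f g : Vector ℤ n} → (∀ i → f i ℤ.≤ g i) → sum f ℤ.≤ sum g
sum-mono {zero}  h = ℤ.≤-refl
sum-mono {suc n} h = ℤ.+-mono-≤ (h zero) (sum-mono (λ i → h (suc i)))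

sum-nonneg : {f : Vector ℤ n} → (∀ i → 0ℤ ℤ.≤ f i) → 0ℤ ℤ.≤ sum f
sum-nonneg {n} {f} h = subst (ℤ._≤ sum f) (sum-replicate-zero n) (sum-mono h)

𝟏 : Vector ℤ n
𝟏 _ = 1ℤ

sum-𝟏 : ∀ n → sum (𝟏 {n}) ≡ + n
sum-𝟏 zero    = refl
sum-𝟏 (suc n) = cong (λ k → 1ℤ + k) (sum-𝟏 n)

-- A scaled vector together with a value for its sum; lists of these let a sum
-- be evaluated linearly after one pointwise ring identity.
record Term (n : ℕ) : Set where
  constructor term
  field
    coefficient : ℤ
    vector      : Vector ℤ n
    {total}     : ℤ
    sum≡total   : sum vector ≡ total

open Term

-- The fold ends in `0ℤ`, and so do the `expand` and `collect` identities below, which have to match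
-- it definitionally.
combination : List (Term n) → Vector ℤ n
combination []      i = 0ℤ
combination (τ ∷ L) i = coefficient τ * vector τ i + combination L i

evaluation : List (Term n) → ℤ
evaluation []      = 0ℤ
evaluation (τ ∷ L) = coefficient τ * total τ + evaluation L

sum-combination : (L : List (Term n)) → sum (combination L) ≡ evaluation L
sum-combination {n} []                  = sum-replicate-zero n
sum-combination     (term c f refl ∷ L) = trans (∑-distrib-+ (λ i → c * f i) (combination L))
  (cong₂ _+_ (sym (*-distribˡ-sum c f)) (sum-combination L))

-- Inner products, Cauchy-Schwarz and a Gram determinant.

infix 7 _∙_

_∙_ : Vector ℤ n → Vector ℤ n → ℤ
x ∙ y = sum (λ i → x i * y i)

∙-comm : (x y : Vector ℤ n) → x ∙ y ≡ y ∙ x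
∙-comm x y = sum-cong-≗ (λ i → ℤ.*-comm (x i) (y i))

∙-congˡ : (x : Vector ℤ n) {y z : Vector ℤ n} → y ≗ z → x ∙ y ≡ x ∙ z
∙-congˡ x h = sum-cong-≗ (λ i → cong (x i *_) (h i))

∙-congʳ : (x : Vector ℤ n) {y z : Vector ℤ n} → y ≗ z → y ∙ x ≡ z ∙ x
∙-congʳ x h = sum-cong-≗ (λ i → cong (_* x i) (h i))

-- Lagrange's identity: twice the defect is the double sum of the squares (xᵢyⱼ - xⱼyᵢ)².
cauchy-schwarz : (x y : Vector ℤ n) → 0ℤ ℤ.≤ (x ∙ x) * (y ∙ y) - (x ∙ y) * (x ∙ y)
cauchy-schwarz {n} x y = nonneg-cancelˡ 2 (subst (0ℤ ℤ.≤_) lagrange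
    (sum-nonneg (λ i → sum-nonneg (λ j → square-nonneg (x i * y j - x j * y i)))))
  where
  expand : ∀ a b c d → (a * d - c * b) * (a * d - c * b)
    ≡ a * a * (d * d) + (b * b * (c * c) + (- (+ 2 * a * b) * (c * d) + 0ℤ))
  expand = solve-∀
  -- Once the sum over j is evaluated, the products of x i and y i become the vectors and the inner
  -- products become the coefficients.
  regroup : ∀ a b p q r → a * a * p + (b * b * q + (- (+ 2 * a * b) * r + 0ℤ))
    ≡ p * (a * a) + (q * (b * b) + (- (+ 2 * r) * (a * b) + 0ℤ))
  regroup = solve-∀
  collect : ∀ p q r → p * q + (q * p + (- (+ 2 * r) * r + 0ℤ)) ≡ + 2 * (q * p - r * r)
  collect = solve-∀
  lagrange : ∑[ i < n ] ∑[ j < n ] ((x i * y j - x j * y i) * (x i * y j - x j * y i))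
           ≡ + 2 * ((x ∙ x) * (y ∙ y) - (x ∙ y) * (x ∙ y))
  lagrange = begin
    ∑[ i < n ] ∑[ j < n ] ((x i * y j - x j * y i) * (x i * y j - x j * y i))
      ≡⟨ sum-cong-≗ (λ i → trans (sum-cong-≗ (λ j → expand (x i) (y i) (x j) (y j)))
           (trans (sum-combination (term (x i * x i) (λ j → y j * y j) refl ∷ term (y i * y i) (λ j → x j * x j) refl
                                     ∷ term (- (+ 2 * x i * y i)) (λ j → x j * y j) refl ∷ []))
                  (regroup (x i) (y i) (y ∙ y) (x ∙ x) (x ∙ y)))) ⟩
    _ ≡⟨ sum-combination (term (y ∙ y) (λ i → x i * x i) refl ∷ term (x ∙ x) (λ i → y i * y i) refl
                          ∷ term (- (+ 2 * (x ∙ y))) (λ i → x i * y i) refl ∷ []) ⟩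
    _ ≡⟨ collect (y ∙ y) (x ∙ x) (x ∙ y) ⟩
    _ ∎

-- The Gram determinant of x, y and 𝟏, by Cauchy–Schwarz for the projections of n x and n y orthogonal to 𝟏.
gram-nonneg : .{{_ : NonZero n}} (x y : Vector ℤ n) →
  0ℤ ℤ.≤ + n * ((x ∙ x) * (y ∙ y)) + + 2 * ((x ∙ y) * (x ∙ 𝟏) * (y ∙ 𝟏))
         - (x ∙ x) * ((y ∙ 𝟏) * (y ∙ 𝟏)) - (y ∙ y) * ((x ∙ 𝟏) * (x ∙ 𝟏)) - + n * ((x ∙ y) * (x ∙ y))
-- Each inner product of centred vectors carries a factor n, which gives n²; the remaining 2 × 2
-- determinant is n times the Gram determinant.
gram-nonneg {n} x y = nonneg-cancelˡ n (nonneg-cancelˡ n (nonneg-cancelˡ n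
  (subst (0ℤ ℤ.≤_)
    (trans (cong₂ _-_ (cong₂ _*_ (centred-∙ x x) (centred-∙ y y)) (cong₂ _*_ (centred-∙ x y) (centred-∙ x y)))
           (factor (+ n) (x ∙ x) (y ∙ y) (x ∙ y) (x ∙ 𝟏) (y ∙ 𝟏)))
    (cauchy-schwarz (centred x) (centred y)))))
  where
  centred : Vector ℤ n → Vector ℤ n
  centred z i = + n * z i - z ∙ 𝟏
  expand : ∀ N a b s t → (N * a - s) * (N * b - t)
    ≡ N * N * (a * b) + (- (N * t) * (a * 1ℤ) + (- (N * s) * (b * 1ℤ) + (s * t * 1ℤ + 0ℤ)))
  expand = solve-∀
  collect : ∀ N p s t → N * N * p + (- (N * t) * s + (- (N * s) * t + (s * t * N + 0ℤ))) ≡ N * (N * p - s * t)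
  collect = solve-∀
  centred-∙ : ∀ z w → centred z ∙ centred w ≡ + n * (+ n * (z ∙ w) - (z ∙ 𝟏) * (w ∙ 𝟏))
  centred-∙ z w = begin
    centred z ∙ centred w
      ≡⟨ sum-cong-≗ (λ i → expand (+ n) (z i) (w i) (z ∙ 𝟏) (w ∙ 𝟏)) ⟩
    _ ≡⟨ sum-combination (term (+ n * + n) (λ i → z i * w i) refl ∷ term (- (+ n * (w ∙ 𝟏))) (λ i → z i * 1ℤ) refl
           ∷ term (- (+ n * (z ∙ 𝟏))) (λ i → w i * 1ℤ) refl ∷ term ((z ∙ 𝟏) * (w ∙ 𝟏)) 𝟏 (sum-𝟏 n) ∷ []) ⟩
    _ ≡⟨ collect (+ n) (z ∙ w) (z ∙ 𝟏) (w ∙ 𝟏) ⟩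
    _ ∎
  factor : ∀ N xx yy xy s t →
    N * (N * xx - s * s) * (N * (N * yy - t * t)) - N * (N * xy - s * t) * (N * (N * xy - s * t))
    ≡ N * (N * (N * (N * (xx * yy) + + 2 * (xy * s * t) - xx * (t * t) - yy * (s * s) - N * (xy * xy))))
  factor = solve-∀

-- Symmetric matrices acting on vectors.

Matrix : ℕ → Set
Matrix n = Fin n → Vector ℤ n

Symmetric : Matrix n → Set
Symmetric X = ∀ i j → X i j ≡ X j i

infixr 8 _·_

_·_ : Matrix n → Vector ℤ n → Vector ℤ n
(X · y) i = X i ∙ y

·-cong : (X : Matrix n) {y z : Vector ℤ n} → y ≗ z → X · y ≗ X · z
·-cong X h i = ∙-congˡ (X i) h

self-adjoint : {X : Matrix n} → Symmetric X → (x y : Vector ℤ n) → x ∙ (X · y) ≡ (X · x) ∙ y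
self-adjoint {n} {X} X-sym x y = begin
  ∑[ i < n ] (x i * (X i ∙ y))
    ≡⟨ sum-cong-≗ (λ i → *-distribˡ-sum (x i) (λ j → X i j * y j)) ⟩
  ∑[ i < n ] ∑[ j < n ] (x i * (X i j * y j))
    ≡⟨ ∑-comm (λ i j → x i * (X i j * y j)) ⟩
  ∑[ j < n ] ∑[ i < n ] (x i * (X i j * y j))
    ≡⟨ sum-cong-≗ (λ j → trans (sum-cong-≗ (λ i → trans (rearrange (x i) (X i j) (y j))
         (cong (λ e → e * x i * y j) (X-sym i j)))) (sym (*-distribʳ-sum (y j) (λ i → X j i * x i)))) ⟩
  ∑[ j < n ] ((X j ∙ x) * y j) ∎
  where
  rearrange : ∀ a b c → a * (b * c) ≡ b * a * c
  rearrange = solve-∀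

-- This is X², for symmetric X.
square : Matrix n → Matrix n
square X i j = X i ∙ X j

square-sym : (X : Matrix n) → Symmetric (square X)
square-sym X i j = ∙-comm (X i) (X j)

-- By `square-sym` the row `square X i` is `X · X i`, and self-adjointness moves the outer `X` onto
-- `y`.
square-· : {X : Matrix n} → Symmetric X → (y : Vector ℤ n) → square X · y ≗ X · X · y
square-· {X = X} X-sym y i = trans (∙-congʳ y (square-sym X i)) (sym (self-adjoint X-sym (X i) y))

-- The trace inequality for a symmetric sign matrix.

module SignMatrix {n} .{{_ : NonZero n}} (A : Matrix n) (A-sym : Symmetric A)
                  (A-sign : ∀ i j → A i j * A i j ≡ 1ℤ) where

  N : ℤ
  N = + n

  a b g : Vector ℤ n
  a = A · 𝟏
  b = A · a
  g = A · b

  P Q : Matrix n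
  P = square A
  Q = square P

  -- With `P` = A² and `Q` = A⁴, the scalars `s`, `q`, `c`, `d` are 𝟏ᵀAᵏ𝟏 for k = 1, 2, 3, 4; the
  -- trace is a polynomial in these, `N` and `w`.
  s q c d w : ℤ
  s = a ∙ 𝟏
  q = a ∙ a
  c = a ∙ b
  d = b ∙ b
  w = ∑[ i < n ] (P i ∙ Q i)

  P-sym : Symmetric P
  P-sym = square-sym A

  P𝟏 : P · 𝟏 ≗ b
  P𝟏 = square-· A-sym 𝟏

  Pa : P · a ≗ g
  Pa = square-· A-sym a

  Q𝟏 : Q · 𝟏 ≗ P · b
  Q𝟏 i = trans (square-· P-sym 𝟏 i) (·-cong P P𝟏 i)

  -- This and the next three evaluations move factors of A across the inner product; they supply
  -- totals for the terms summed below.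
  b∙𝟏 : b ∙ 𝟏 ≡ q
  b∙𝟏 = sym (self-adjoint A-sym a 𝟏)

  g∙𝟏 : g ∙ 𝟏 ≡ c
  g∙𝟏 = trans (sym (self-adjoint A-sym b 𝟏)) (∙-comm b a)

  a∙g : a ∙ g ≡ d
  a∙g = self-adjoint A-sym a b

  Pb∙𝟏 : (P · b) ∙ 𝟏 ≡ d
  Pb∙𝟏 = trans (sym (self-adjoint P-sym b 𝟏)) (∙-congˡ b P𝟏)

  -- w is the trace of A⁶, that is, the squared Frobenius norm of A³.
  w-nonneg : 0ℤ ℤ.≤ w
  w-nonneg = sum-nonneg (λ i → subst (0ℤ ℤ.≤_) (sym (PQ i))
                                 (sum-nonneg (λ j → square-nonneg ((A · P i) j))))
    where
    PQ : ∀ i → P i ∙ Q i ≡ (A · P i) ∙ (A · P i)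
    PQ i = begin
      P i ∙ Q i               ≡⟨ ∙-congˡ (P i) (square-sym P i) ⟩
      P i ∙ (P · P i)         ≡⟨ ∙-congˡ (P i) (square-· A-sym (P i)) ⟩
      P i ∙ (A · A · P i)     ≡⟨ self-adjoint A-sym (P i) (A · P i) ⟩
      (A · P i) ∙ (A · P i)   ∎

  M : Matrix n
  M i j = ∑[ k < n ] ((1ℤ + A i k) * (1ℤ - A k j))

  -- Entrywise form of J² + AJ - JA - A².
  M≡ : ∀ i j → M i j ≡ N + a i - a j - P i j
  M≡ i j = begin
    M i j
      ≡⟨ sum-cong-≗ (λ k → trans (cong (λ e → (1ℤ + A i k) * (1ℤ - e)) (A-sym k j)) (expand (A i k) (A j k))) ⟩
    _ ≡⟨ sum-combination (term 1ℤ 𝟏 (sum-𝟏 n) ∷ term 1ℤ (λ k → A i k * 1ℤ) refl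
           ∷ term (- 1ℤ) (λ k → A j k * 1ℤ) refl ∷ term (- 1ℤ) (λ k → A i k * A j k) refl ∷ []) ⟩
    _ ≡⟨ collect N (a i) (a j) (P i j) ⟩
    _ ∎
    where
    expand : ∀ u v → (1ℤ + u) * (1ℤ - v)
      ≡ 1ℤ * 1ℤ + (1ℤ * (u * 1ℤ) + (- 1ℤ * (v * 1ℤ) + (- 1ℤ * (u * v) + 0ℤ)))
    expand = solve-∀
    collect : ∀ N u v p → 1ℤ * N + (1ℤ * u + (- 1ℤ * v + (- 1ℤ * p + 0ℤ))) ≡ N + u - v - p
    collect = solve-∀

  M² : Matrix n
  M² j i = ∑[ k < n ] (M j k * M k i)

  -- The symmetric and antisymmetric parts, under i ↔ j, of the entry `M² j i`.
  even odd : Matrix n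
  even i j = N * N * N + (a i + a j) * s - N * (b i + b j) - q + Q i j - N * (a i * a j)
  odd  i j = N * N * (a j - a i) - a j * b i + a i * b j + g i - g j

  M²≡ : ∀ i j → M² j i ≡ even i j + odd i j
  M²≡ i j = begin
    M² j i
      ≡⟨ sum-cong-≗ (λ k → trans
           (cong₂ _*_ (M≡ j k) (trans (M≡ k i) (cong (λ e → N + a k - a i - e) (P-sym k i))))
           (expand N (a i) (a j) (a k) (P i k) (P j k))) ⟩
    _ ≡⟨ sum-combination (term ((N + a j) * (N - a i)) 𝟏 (sum-𝟏 n) ∷ term (a i + a j) (λ k → a k * 1ℤ) refl
           ∷ term (- (N + a j)) (λ k → P i k * 1ℤ) (P𝟏 i) ∷ term (- (N - a i)) (λ k → P j k * 1ℤ) (P𝟏 j)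
           ∷ term (- 1ℤ) (λ k → a k * a k) refl ∷ term 1ℤ (λ k → P i k * a k) (Pa i)
           ∷ term (- 1ℤ) (λ k → P j k * a k) (Pa j) ∷ term 1ℤ (λ k → P i k * P j k) refl ∷ []) ⟩
    _ ≡⟨ collect N (a i) (a j) (b i) (b j) (g i) (g j) s q (Q i j) ⟩
    even i j + odd i j ∎
    where
    expand : ∀ N ai aj ak pi pj → (N + aj - ak - pj) * (N + ak - ai - pi)
      ≡ (N + aj) * (N - ai) * 1ℤ + ((ai + aj) * (ak * 1ℤ) + (- (N + aj) * (pi * 1ℤ) + (- (N - ai) * (pj * 1ℤ)
        + (- 1ℤ * (ak * ak) + (1ℤ * (pi * ak) + (- 1ℤ * (pj * ak) + (1ℤ * (pi * pj) + 0ℤ)))))))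
    expand = solve-∀
    collect : ∀ N ai aj bi bj gi gj s q Q → (N + aj) * (N - ai) * N + ((ai + aj) * s + (- (N + aj) * bi + (- (N - ai) * bj
        + (- 1ℤ * q + (1ℤ * gi + (- 1ℤ * gj + (1ℤ * Q + 0ℤ)))))))
      ≡ N * N * N + (ai + aj) * s - N * (bi + bj) - q + Q - N * (ai * aj)
        + (N * N * (aj - ai) - aj * bi + ai * bj + gi - gj)
    collect = solve-∀

  trace : ℤ
  trace = ∑[ i < n ] ∑[ j < n ] (M i j * M² j i)

  -- The part of M i j * M² j i that is symmetric under i ↔ j; the antisymmetric rest sums to zero.
  core : Matrix n
  core i j = (N - P i j) * even i j + (a i - a j) * odd i j

  -- `M i j` splits into the symmetric N - P i j and the antisymmetric a i - a j. Multiplied by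
  -- `even` + `odd`, the mixed-parity products change sign under i ↔ j and cancel.
  symmetrize : ∀ i j → M i j * M² j i + M j i * M² i j ≡ core i j + core i j
  symmetrize i j = begin
    M i j * M² j i + M j i * M² i j
      ≡⟨ cong₂ _+_ (cong₂ _*_ (M≡ i j) (M²≡ i j))
           (cong₂ _*_ (trans (M≡ j i) (cong (λ e → N + a j - a i - e) (P-sym j i)))
                      (trans (M²≡ j i) (cong (λ e → N * N * N + (a j + a i) * s - N * (b j + b i) - q + e
                                                      - N * (a j * a i) + odd j i) (square-sym P j i)))) ⟩
    _ ≡⟨ identity N (a i) (a j) (b i) (b j) (g i) (g j) s q (P i j) (Q i j) ⟩
    core i j + core i j ∎
    where
    identity : ∀ N ai aj bi bj gi gj s q p r →
      (N + ai - aj - p) * (N * N * N + (ai + aj) * s - N * (bi + bj) - q + r - N * (ai * aj)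
                           + (N * N * (aj - ai) - aj * bi + ai * bj + gi - gj))
      + (N + aj - ai - p) * (N * N * N + (aj + ai) * s - N * (bj + bi) - q + r - N * (aj * ai)
                             + (N * N * (ai - aj) - ai * bj + aj * bi + gj - gi))
      ≡ (N - p) * (N * N * N + (ai + aj) * s - N * (bi + bj) - q + r - N * (ai * aj))
        + (ai - aj) * (N * N * (aj - ai) - aj * bi + ai * bj + gi - gj)
        + ((N - p) * (N * N * N + (ai + aj) * s - N * (bi + bj) - q + r - N * (ai * aj))
           + (ai - aj) * (N * N * (aj - ai) - aj * bi + ai * bj + gi - gj))
    identity = solve-∀

  rowSum : Vector ℤ n
  rowSum i = ∑[ j < n ] core i j

  -- The summand `N * (P · b) i` arises twice: from the row sum of `Q` through `Q𝟏`, and from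
  -- pairing `P i` with `b`.
  rowSum≡ : ∀ i → rowSum i ≡
    N * N * (N * N * N + a i * s - N * b i - q) + N * a i * (g i - N * N * a i)
    + s * (N * s + N * N * a i - a i * b i - g i) + q * (a i * a i - N * N) - c * a i
    + N * (P · b) i + q * (b i - N * N) - a i * c + d
    - b i * (N * N * N + a i * s - N * b i - q) - g i * (s - N * a i) + N * (P · b) i - P i ∙ Q i
  rowSum≡ i = begin
    rowSum i
      ≡⟨ sum-cong-≗ (λ j → expand N (a i) (a j) (b i) (b j) (g i) (g j) s q (P i j) (Q i j)) ⟩
    _ ≡⟨ sum-combination
           (term (N * (N * N * N + a i * s - N * b i - q) + a i * (g i - N * N * a i)) 𝟏 (sum-𝟏 n)
           ∷ term (N * s + N * N * a i - a i * b i - g i) (λ j → a j * 1ℤ) refl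
           ∷ term (a i * a i - N * N) (λ j → b j * 1ℤ) b∙𝟏
           ∷ term (- a i) (λ j → g j * 1ℤ) g∙𝟏
           ∷ term N (λ j → Q i j * 1ℤ) (Q𝟏 i)
           ∷ term (b i - N * N) (λ j → a j * a j) refl
           ∷ term (- a i) (λ j → a j * b j) refl
           ∷ term 1ℤ (λ j → a j * g j) a∙g
           ∷ term (- (N * N * N + a i * s - N * b i - q)) (λ j → P i j * 1ℤ) (P𝟏 i)
           ∷ term (- (s - N * a i)) (λ j → P i j * a j) (Pa i)
           ∷ term N (λ j → P i j * b j) refl
           ∷ term (- 1ℤ) (λ j → P i j * Q i j) refl ∷ []) ⟩
    _ ≡⟨ collect N (a i) (b i) (g i) s q c d ((P · b) i) (P i ∙ Q i) ⟩
    _ ∎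
    where
    expand : ∀ N ai aj bi bj gi gj s q p r →
      (N - p) * (N * N * N + (ai + aj) * s - N * (bi + bj) - q + r - N * (ai * aj))
      + (ai - aj) * (N * N * (aj - ai) - aj * bi + ai * bj + gi - gj)
      ≡ (N * (N * N * N + ai * s - N * bi - q) + ai * (gi - N * N * ai)) * 1ℤ
        + ((N * s + N * N * ai - ai * bi - gi) * (aj * 1ℤ)
        + ((ai * ai - N * N) * (bj * 1ℤ)
        + (- ai * (gj * 1ℤ)
        + (N * (r * 1ℤ)
        + ((bi - N * N) * (aj * aj)
        + (- ai * (aj * bj)
        + (1ℤ * (aj * gj)
        + (- (N * N * N + ai * s - N * bi - q) * (p * 1ℤ)
        + (- (s - N * ai) * (p * aj)
        + (N * (p * bj)
        + (- 1ℤ * (p * r) + 0ℤ)))))))))))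
    expand = solve-∀
    collect : ∀ N ai bi gi s q c d h w →
      (N * (N * N * N + ai * s - N * bi - q) + ai * (gi - N * N * ai)) * N
        + ((N * s + N * N * ai - ai * bi - gi) * s
        + ((ai * ai - N * N) * q
        + (- ai * c
        + (N * h
        + ((bi - N * N) * q
        + (- ai * c
        + (1ℤ * d
        + (- (N * N * N + ai * s - N * bi - q) * bi
        + (- (s - N * ai) * gi
        + (N * h
        + (- 1ℤ * w + 0ℤ)))))))))))
      ≡ N * N * (N * N * N + ai * s - N * bi - q) + N * ai * (gi - N * N * ai)
        + s * (N * s + N * N * ai - ai * bi - gi) + q * (ai * ai - N * N) - c * ai
        + N * h + q * (bi - N * N) - ai * c + d
        - bi * (N * N * N + ai * s - N * bi - q) - gi * (s - N * ai) + N * h - w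
    collect = solve-∀

  -- The trace is added to itself with i and j exchanged, so that only `core` has to be summed; the
  -- factor 2 is cancelled at the end.
  trace≡ : trace ≡ N * N * N * N * N * N + + 3 * (N * N * s * s) - + 6 * (N * N * N * q) + + 6 * (N * d)
                 - + 6 * (s * c) + + 3 * (q * q) - w
  trace≡ = ℤ.*-cancelˡ-≡ (+ 2) trace _ (begin
    + 2 * trace ≡⟨ double trace ⟨
    trace + trace
      ≡⟨ cong (λ e → trace + e) (∑-comm (λ i j → M i j * M² j i)) ⟩
    trace + ∑[ i < n ] ∑[ j < n ] (M j i * M² i j)
      ≡⟨ ∑-distrib-+ (λ i → ∑[ j < n ] (M i j * M² j i)) (λ i → ∑[ j < n ] (M j i * M² i j)) ⟨
    ∑[ i < n ] (∑[ j < n ] (M i j * M² j i) + ∑[ j < n ] (M j i * M² i j))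
      ≡⟨ sum-cong-≗ (λ i → trans (sym (∑-distrib-+ (λ j → M i j * M² j i) (λ j → M j i * M² i j)))
           (trans (sum-cong-≗ (symmetrize i)) (∑-distrib-+ (core i) (core i)))) ⟩
    ∑[ i < n ] (rowSum i + rowSum i)
      ≡⟨ sum-cong-≗ (λ i → trans (cong₂ _+_ (rowSum≡ i) (rowSum≡ i))
           (expand N (a i) (b i) (g i) s q c d ((P · b) i) (P i ∙ Q i))) ⟩
    _ ≡⟨ sum-combination
           (term (+ 2 * (N * N * N * N * N - + 3 * (N * N * q) + N * s * s + d)) 𝟏 (sum-𝟏 n)
           ∷ term (+ 2 * (+ 2 * (N * N * s) - + 2 * c)) (λ i → a i * 1ℤ) refl
           ∷ term (+ 2 * (+ 2 * q - + 2 * (N * N * N))) (λ i → b i * 1ℤ) b∙𝟏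
           ∷ term (- (+ 4 * s)) (λ i → g i * 1ℤ) g∙𝟏
           ∷ term (+ 2 * (q - N * N * N)) (λ i → a i * a i) refl
           ∷ term (- (+ 4 * s)) (λ i → a i * b i) refl
           ∷ term (+ 4 * N) (λ i → a i * g i) a∙g
           ∷ term (+ 4 * N) (λ i → (P · b) i * 1ℤ) Pb∙𝟏
           ∷ term (+ 2 * N) (λ i → b i * b i) refl
           ∷ term (- + 2) (λ i → P i ∙ Q i) refl ∷ []) ⟩
    _ ≡⟨ collect N s q c d w ⟩
    _ ∎)
    where
    double : ∀ x → x + x ≡ + 2 * x
    double = solve-∀
    expand : ∀ N ai bi gi s q c d h w →
      (N * N * (N * N * N + ai * s - N * bi - q) + N * ai * (gi - N * N * ai)
        + s * (N * s + N * N * ai - ai * bi - gi) + q * (ai * ai - N * N) - c * ai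
        + N * h + q * (bi - N * N) - ai * c + d
        - bi * (N * N * N + ai * s - N * bi - q) - gi * (s - N * ai) + N * h - w)
      + (N * N * (N * N * N + ai * s - N * bi - q) + N * ai * (gi - N * N * ai)
        + s * (N * s + N * N * ai - ai * bi - gi) + q * (ai * ai - N * N) - c * ai
        + N * h + q * (bi - N * N) - ai * c + d
        - bi * (N * N * N + ai * s - N * bi - q) - gi * (s - N * ai) + N * h - w)
      ≡ + 2 * (N * N * N * N * N - + 3 * (N * N * q) + N * s * s + d) * 1ℤ
        + (+ 2 * (+ 2 * (N * N * s) - + 2 * c) * (ai * 1ℤ)
        + (+ 2 * (+ 2 * q - + 2 * (N * N * N)) * (bi * 1ℤ)
        + (- (+ 4 * s) * (gi * 1ℤ)
        + (+ 2 * (q - N * N * N) * (ai * ai)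
        + (- (+ 4 * s) * (ai * bi)
        + (+ 4 * N * (ai * gi)
        + (+ 4 * N * (h * 1ℤ)
        + (+ 2 * N * (bi * bi)
        + (- + 2 * w + 0ℤ)))))))))
    expand = solve-∀
    collect : ∀ N s q c d w →
      + 2 * (N * N * N * N * N - + 3 * (N * N * q) + N * s * s + d) * N
        + (+ 2 * (+ 2 * (N * N * s) - + 2 * c) * s
        + (+ 2 * (+ 2 * q - + 2 * (N * N * N)) * q
        + (- (+ 4 * s) * c
        + (+ 2 * (q - N * N * N) * q
        + (- (+ 4 * s) * c
        + (+ 4 * N * d
        + (+ 4 * N * d
        + (+ 2 * N * d
        + (- + 2 * w + 0ℤ)))))))))
      ≡ + 2 * (N * N * N * N * N * N + + 3 * (N * N * s * s) - + 6 * (N * N * N * q) + + 6 * (N * d)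
                 - + 6 * (s * c) + + 3 * (q * q) - w)
    collect = solve-∀

  -- A Cauchy–Schwarz defect and a Gram determinant for the vectors A i, a and 𝟏.
  slack : Vector ℤ n
  slack i = N * (N * q - b i * b i)
    + (N * (N * q) + + 2 * (b i * a i * s) - N * (s * s) - q * (a i * a i) - N * (b i * b i))

  slack-nonneg : ∀ i → 0ℤ ℤ.≤ slack i
  -- `A i ∙ a` is `b i` and `A i ∙ 𝟏` is `a i` by definition; only the squared norm of a row, n
  -- because its entries are ±1, needs rewriting.
  slack-nonneg i = ℤ.+-mono-≤
    (*-nonneg {N} (ℤ.+≤+ z≤n)
      (subst (λ e → 0ℤ ℤ.≤ e * q - b i * b i) unit-rows (cauchy-schwarz (A i) a)))
    (subst (λ e → 0ℤ ℤ.≤ N * (e * q) + + 2 * (b i * a i * s) - e * (s * s) - q * (a i * a i) - N * (b i * b i))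
      unit-rows (gram-nonneg (A i) a))
    where
    unit-rows : A i ∙ A i ≡ N
    unit-rows = trans (sum-cong-≗ (A-sign i)) (sum-𝟏 n)

  -- Summed over i, the products b i * b i, a i * b i and a i * a i become `d`, `c` and `q`, which
  -- turns the sum of `slack` into a polynomial comparable with `trace≡`.
  trace-slack : N * N * N * N * N * N - trace ≡ w + + 3 * sum slack
  trace-slack = begin
    N * N * N * N * N * N - trace ≡⟨ cong (λ e → N * N * N * N * N * N - e) trace≡ ⟩
    _ ≡⟨ collect N s q c d w ⟩
    _ ≡⟨ cong (λ e → w + + 3 * e) (trans (sum-cong-≗ (λ i → expand N (a i) (b i) s q)) (sum-combination
           (term (+ 2 * (N * N * q) - N * (s * s)) 𝟏 (sum-𝟏 n) ∷ term (- (+ 2 * N)) (λ i → b i * b i) refl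
           ∷ term (+ 2 * s) (λ i → a i * b i) refl ∷ term (- q) (λ i → a i * a i) refl ∷ []))) ⟨
    w + + 3 * sum slack ∎
    where
    expand : ∀ N ai bi s q →
      N * (N * q - bi * bi) + (N * (N * q) + + 2 * (bi * ai * s) - N * (s * s) - q * (ai * ai) - N * (bi * bi))
      ≡ (+ 2 * (N * N * q) - N * (s * s)) * 1ℤ + (- (+ 2 * N) * (bi * bi) + (+ 2 * s * (ai * bi)
        + (- q * (ai * ai) + 0ℤ)))
    expand = solve-∀
    collect : ∀ N s q c d w →
      N * N * N * N * N * N - (N * N * N * N * N * N + + 3 * (N * N * s * s) - + 6 * (N * N * N * q) + + 6 * (N * d)
                               - + 6 * (s * c) + + 3 * (q * q) - w)
      ≡ w + + 3 * ((+ 2 * (N * N * q) - N * (s * s)) * N + (- (+ 2 * N) * d + (+ 2 * s * c + (- q * q + 0ℤ))))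
    collect = solve-∀

  trace-≤ : trace ℤ.≤ N * N * N * N * N * N
  trace-≤ = ℤ.0≤i-j⇒j≤i (subst (0ℤ ℤ.≤_) (sym trace-slack)
    (ℤ.+-mono-≤ w-nonneg (*-nonneg {+ 3} (ℤ.+≤+ z≤n) (sum-nonneg slack-nonneg))))

-- Weighted sums over lists and over all maps.

weighted : {X : Set} → (X → ℤ) → List X → ℤ
weighted w []       = 0ℤ
weighted w (x ∷ xs) = w x + weighted w xs

weighted-++ : {X : Set} (w : X → ℤ) (xs ys : List X) → weighted w (xs ++ ys) ≡ weighted w xs + weighted w ys
weighted-++ w []       ys = sym (ℤ.+-identityˡ _)
weighted-++ w (x ∷ xs) ys = trans (cong (λ e → w x + e) (weighted-++ w xs ys)) (sym (ℤ.+-assoc (w x) _ _))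

weighted-map : {X Y : Set} (w : Y → ℤ) (h : X → Y) (xs : List X) → weighted w (map h xs) ≡ weighted (λ x → w (h x)) xs
weighted-map w h []       = refl
weighted-map w h (x ∷ xs) = cong (λ e → w (h x) + e) (weighted-map w h xs)

weighted-concatMap : {X Y : Set} (w : Y → ℤ) (h : X → List Y) (x : Fin n → X) →
  weighted w (concatMap h (tabulate x)) ≡ ∑[ i < n ] weighted w (h (x i))
weighted-concatMap {zero}  w h x = refl
weighted-concatMap {suc n} w h x = trans (weighted-++ w (h (x zero)) _)
  (cong (λ e → weighted w (h (x zero)) + e) (weighted-concatMap w h (λ i → x (suc i))))

-- Each element kept by the filter weighs exactly κ and the others weigh at least 0. This bounds the
-- homomorphism count by a total weight.
filter-≤-weighted : {X : Set} {S : X → Set} (S? : ∀ x → Dec (S x)) (w : X → ℤ) (κ : ℤ) →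
  (∀ x → 0ℤ ℤ.≤ w x) → (∀ x → S x → κ ≡ w x) → ∀ xs → κ * + length (filter S? xs) ℤ.≤ weighted w xs
filter-≤-weighted S? w κ w≥0 κ≡w []       = ℤ.≤-reflexive (ℤ.*-zeroʳ κ)
filter-≤-weighted S? w κ w≥0 κ≡w (x ∷ xs) with S? x | filter-≤-weighted S? w κ w≥0 κ≡w xs
... | yes Sx | ih = subst (ℤ._≤ _) (sym (ℤ.*-suc κ _)) (ℤ.+-mono-≤ (ℤ.≤-reflexive (κ≡w x Sx)) ih)
... | no  _  | ih = subst (ℤ._≤ w x + weighted w xs) (ℤ.+-identityˡ _) (ℤ.+-mono-≤ (w≥0 x) ih)

-- Nested in the order of `allMaps`, so that for k = 6 it unfolds to an iterated sum over the six
-- vertices.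
∑maps : ∀ k → (Vec (Fin n) k → ℤ) → ℤ
∑maps         zero    w = w []
∑maps {n = n} (suc k) w = ∑[ x < n ] ∑maps k (λ f → w (x ∷ f))

weighted-allMaps : ∀ k (w : Vec (Fin n) k → ℤ) → weighted w (allMaps k n) ≡ ∑maps k w
weighted-allMaps         zero    w = ℤ.+-identityʳ (w [])
weighted-allMaps {n = n} (suc k) w = trans (weighted-concatMap w (λ x → map (x ∷_) (allMaps k n)) (λ x → x))
  (sum-cong-≗ (λ x → trans (weighted-map w (x ∷_) (allMaps k n)) (weighted-allMaps k (λ f → w (x ∷ f)))))

pull-out₂ : ∀ κ (F : Matrix n) → ∑[ i < n ] ∑[ j < n ] (κ * F i j) ≡ κ * (∑[ i < n ] ∑[ j < n ] F i j)
pull-out₂ κ F = trans (sum-cong-≗ (λ i → sym (*-distribˡ-sum κ (F i)))) (sym (*-distribˡ-sum κ (λ i → sum (F i))))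

-- Homomorphisms of the alternating 6-cycle and the trace.

-- Uncoloured pairs count as −1, the diagonal included.
sign : Maybe Colour → ℤ
sign (just red)  = 1ℤ
sign (just blue) = -1ℤ
sign nothing     = -1ℤ

sign² : ∀ m → sign m * sign m ≡ 1ℤ
sign² (just red)  = refl
sign² (just blue) = refl
sign² nothing     = refl

1+sign-nonneg : ∀ m → 0ℤ ℤ.≤ 1ℤ + sign m
1+sign-nonneg (just red)  = ℤ.+≤+ z≤n
1+sign-nonneg (just blue) = ℤ.+≤+ z≤n
1+sign-nonneg nothing     = ℤ.+≤+ z≤n

1-sign-nonneg : ∀ m → 0ℤ ℤ.≤ 1ℤ - sign m
1-sign-nonneg (just red)  = ℤ.+≤+ z≤n
1-sign-nonneg (just blue) = ℤ.+≤+ z≤n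
1-sign-nonneg nothing     = ℤ.+≤+ z≤n

module _ {n : ℕ} .{{_ : NonZero n}} (G : ECGraph n) where

  A : Matrix n
  A i j = sign (col G i j)

  open SignMatrix A (λ i j → cong sign (ECGraph.sym G i j)) (λ i j → sign² (col G i j))

  -- Four times the indicator that ik is red and kj is not red; summing out the middle vertex k
  -- gives `M i j`.
  step : Fin n → Fin n → Fin n → ℤ
  step i k j = (1ℤ + A i k) * (1ℤ - A k j)

  step-nonneg : ∀ i k j → 0ℤ ℤ.≤ step i k j
  step-nonneg i k j = *-nonneg (1+sign-nonneg (col G i k)) (1-sign-nonneg (col G k j))

  weight : Vec (Fin n) 6 → ℤ
  weight (x₀ ∷ x₁ ∷ x₂ ∷ x₃ ∷ x₄ ∷ x₅ ∷ []) = step x₀ x₁ x₂ * (step x₂ x₃ x₄ * step x₄ x₅ x₀)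

  weight-nonneg : ∀ f → 0ℤ ℤ.≤ weight f
  weight-nonneg (x₀ ∷ x₁ ∷ x₂ ∷ x₃ ∷ x₄ ∷ x₅ ∷ []) =
    *-nonneg (step-nonneg x₀ x₁ x₂) (*-nonneg (step-nonneg x₂ x₃ x₄) (step-nonneg x₄ x₅ x₀))

  -- The 6-cycle consists of three red-blue paths joining its even vertices, each contributing 4,
  -- and 4³ = 64.
  weight-hom : ∀ f → IsHom C6A G f → + 64 ≡ weight f
  weight-hom (x₀ ∷ x₁ ∷ x₂ ∷ x₃ ∷ x₄ ∷ x₅ ∷ []) h =
    cong₂ _*_ (hom-step (h 0F 1F) (h 1F 2F)) (cong₂ _*_ (hom-step (h 2F 3F) (h 3F 4F)) (hom-step (h 4F 5F) (h 5F 0F)))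
    where
    hom-step : ∀ {i k j} → col G i k ≡ just red → col G k j ≡ just blue → + 4 ≡ step i k j
    hom-step ik kj = cong₂ (λ l m → (1ℤ + sign l) * (1ℤ - sign m)) (sym ik) (sym kj)

  contract : ∀ i (z : Vector ℤ n) → ∑[ k < n ] ∑[ j < n ] (step i k j * z j) ≡ ∑[ j < n ] (M i j * z j)
  contract i z = trans (∑-comm (λ k j → step i k j * z j))
    (sum-cong-≗ (λ j → sym (*-distribʳ-sum (z j) (λ k → step i k j))))

  -- The odd vertices are summed out: x₅ gives `M x₄ x₀` by definition, x₃ together with x₄ gives
  -- `M² x₂ x₀`, and x₁ leaves the trace as a sum over x₀ and x₂.
  ∑weight : ∑maps 6 weight ≡ trace
  ∑weight = sum-cong-≗ (λ x₀ → trans (sum-cong-≗ (λ x₁ → sum-cong-≗ (λ x₂ → inner x₀ x₁ x₂)))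
                                     (contract x₀ (λ x₂ → M² x₂ x₀)))
    where
    inner : ∀ x₀ x₁ x₂ →
      ∑[ x₃ < n ] ∑[ x₄ < n ] ∑[ x₅ < n ] (step x₀ x₁ x₂ * (step x₂ x₃ x₄ * step x₄ x₅ x₀))
      ≡ step x₀ x₁ x₂ * M² x₂ x₀
    inner x₀ x₁ x₂ = begin
      ∑[ x₃ < n ] ∑[ x₄ < n ] ∑[ x₅ < n ] (step x₀ x₁ x₂ * (step x₂ x₃ x₄ * step x₄ x₅ x₀))
        ≡⟨ sum-cong-≗ (λ x₃ → pull-out₂ (step x₀ x₁ x₂) (λ x₄ x₅ → step x₂ x₃ x₄ * step x₄ x₅ x₀)) ⟩
      ∑[ x₃ < n ] (step x₀ x₁ x₂ * (∑[ x₄ < n ] ∑[ x₅ < n ] (step x₂ x₃ x₄ * step x₄ x₅ x₀)))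
        ≡⟨ *-distribˡ-sum (step x₀ x₁ x₂) (λ x₃ → ∑[ x₄ < n ] ∑[ x₅ < n ] (step x₂ x₃ x₄ * step x₄ x₅ x₀)) ⟨
      step x₀ x₁ x₂ * (∑[ x₃ < n ] ∑[ x₄ < n ] ∑[ x₅ < n ] (step x₂ x₃ x₄ * step x₄ x₅ x₀))
        ≡⟨ cong (λ e → step x₀ x₁ x₂ * e) (sum-cong-≗ (λ x₃ → sum-cong-≗ (λ x₄ →
             sym (*-distribˡ-sum (step x₂ x₃ x₄) (λ x₅ → step x₄ x₅ x₀))))) ⟩
      step x₀ x₁ x₂ * (∑[ x₃ < n ] ∑[ x₄ < n ] (step x₂ x₃ x₄ * M x₄ x₀))
        ≡⟨ cong (λ e → step x₀ x₁ x₂ * e) (contract x₂ (λ x₄ → M x₄ x₀)) ⟩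
      step x₀ x₁ x₂ * M² x₂ x₀ ∎

  pos-^6 : N * N * N * N * N * N ≡ + (n ^ 6)
  pos-^6 = trans (reassociate N) (sym (pos-^ 6))
    where
    pos-^ : ∀ k → + (n ^ k) ≡ N ℤ.^ k
    pos-^ zero    = refl
    pos-^ (suc k) = trans (ℤ.pos-* n (n ^ k)) (cong (λ e → N * e) (pos-^ k))
    reassociate : ∀ x → x * x * x * x * x * x ≡ x * (x * (x * (x * (x * (x * 1ℤ)))))
    reassociate = solve-∀

  hom-C6A-≤ : + 64 * + hom C6A G ℤ.≤ + (n ^ 6)
  hom-C6A-≤ = ℤ.≤-trans
    (filter-≤-weighted (isHom? C6A G) weight (+ 64) weight-nonneg weight-hom (allMaps 6 n))
    (subst₂ ℤ._≤_ (sym (trans (weighted-allMaps 6 weight) ∑weight)) pos-^6 trace-≤)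

-- From integer counts to rational densities.

/-≤-half^6 : ∀ m d .{{_ : NonZero d}} → + 64 * + m ℤ.≤ + d → (+ m) / d ≤ half^6
/-≤-half^6 m (suc d) h = ℚ.toℚᵘ-cancel-≤ (ℚᵘ.≤-trans
  (ℚᵘ.≤-reflexive (ℚ.toℚᵘ-fromℚᵘ (ℚᵘ.mkℚᵘ (+ m) d)))
  -- `half^6` computes to 1/64, so cross-multiplication leaves m * 64 ≤ 1 * (d + 1), where the
  -- denominator is `suc d`.
  (ℚᵘ.*≤* (subst₂ ℤ._≤_ (ℤ.*-comm (+ 64) (+ m)) (sym (ℤ.*-identityˡ (+ suc d))) h)))

theorem1 : ∀ {n : ℕ} (G : ECGraph n) .{{_ : NonZero n}} → t C6A G ≤ half^6
theorem1 {n} G = /-≤-half^6 (hom C6A G) (n ^ 6) {{m^n≢0 n 6}} (hom-C6A-≤ G)
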